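{- For every closed guarded expression $\phi\in\mathcal{E}_0$, every $T$-coalgebra $C=(X,\xi)$ and every state $x\in X$: $x\in[\![\phi]\!]_C$ if and only if $x$ is behaviourally equivalent to $\phi$ regarded as a state of the coalgebra $(\mathcal{E}_0,\varepsilon)$. In particular, $\phi\in[\![\phi]\!]_{(\mathcal{E}_0,\varepsilon)}$ for all $\phi\in\mathcal{E}_0$.
   Context: Standing assumptions: $T:\mathbf{Set}\to\mathbf{Set}$ is a functor; $\mathcal{L}$ is a set of modalities with arities ($L/n$), each $L/n$ assigned an $n$-ary monotone singleton-preserving predicate lifting $[\![L]\!]$ for $T$ such that $\Lambda=\{[\![L]\!]\mid L\in\mathcal{L}\}$ is strongly expressive. (An $n$-ary predicate lifting is a family $\lambda_X:(\mathcal{P}X)^n\to\mathcal{P}(TX)$ with $\lambda_X(f^{ -1}[A_1],\dots,f^{ -1}[A_n])=(Tf)^{ -1}[\lambda_Y(A_1,\dots,A_n)]$ for $f:X\to Y$; monotone if monotone in each argument; singleton-preserving if $|\lambda_X(\{x_1\},\dots,\{x_n\})|=1$ for all $x_i\in X$; $\Lambda$ strongly expressive if for every set $X$ and $t\in TX$ there are $\lambda/n\in\Lambda$, $x_i\in X$ with $\{t\}=\lambda_X(\{x_1\},\dots,\{x_n\})$.) Fix a set $V$ of variables. Expressions: $\phi::=z\mid\nu z.\,\phi\mid L(\phi_1,\dots,\phi_n)$. Closed: every variable occurrence bound by a $\nu$; guarded: every variable occurrence separated from its binding $\nu$ by at least one modality; $\mathcal{E}_0$ = closed guarded expressions. Semantics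 in $C=(X,\xi)$ under valuation $\kappa:V\to\mathcal{P}X$: $[\![z]\!]^\kappa=\kappa(z)$; $[\![L(\phi_1,\dots,\phi_n)]\!]^\kappa=\xi^{ -1}[[\![L]\!]_X([\![\phi_1]\!]^\kappa,\dots,[\![\phi_n]\!]^\kappa)]$; $[\![\nu z.\phi]\!]^\kappa=$ greatest fixed point of $Y\mapsto[\![\phi]\!]^{\kappa[z\mapsto Y]}$; for closed $\phi$ write $[\![\phi]\!]_C$. The coalgebra $\varepsilon:\mathcal{E}_0\to T\mathcal{E}_0$ is defined by $\varepsilon(L(\phi_1,\dots,\phi_n))=$ the unique element of $[\![L]\!]_{\mathcal{E}_0}(\{\phi_1\},\dots,\{\phi_n\})$ and $\varepsilon(\nu x.\phi)=\varepsilon(\phi[\nu x.\phi/x])$ (well-defined by induction on the number of $\nu$'s not in the scope of a modality). States are behaviourally equivalent if coalgebra morphisms (maps $h$ with $Th\circ\xi=\zeta\circ h$) into a common coalgebra identify them. -}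

module Defs where

open import Axiom.ExcludedMiddle using (ExcludedMiddle)
open import Data.Empty using (⊥; ⊥-elim; ⊥-elim-irr)
open import Data.Fin using (Fin; zero; suc)
open import Data.List using (List; []; _∷_)
open import Data.List.Membership.Propositional using (_∈_; _∉_)
open import Data.List.Relation.Unary.Any using (here; there)
open import Data.Nat using (ℕ; zero; suc)
import Data.Nat.Properties as ℕ
open import Data.Product using (∃; ∃₂; ∃!; _×_; _,_; proj₁; proj₂)
open import Data.Vec using (Vec; []; _∷_; lookup)
open import Data.Vec.Relation.Unary.All using (All; []; _∷_)
open import Data.Vec.Relation.Unary.All.Properties using (lookup⁺)
open import Function using (_∘_; id)
open import Level using (0ℓ; Lift; lift; lower) renaming (suc to lsuc)
open import Relation.Binary.Definitions using (DecidableEquality)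
open import Relation.Binary.PropositionalEquality
  using (_≡_; _≢_; _≗_; refl; sym; trans; cong; subst)
open import Relation.Nullary using (yes; no)
open import Relation.Nullary.Decidable
  using (True; toWitness; fromWitness; map′; recompute)
open import Relation.Unary using (Pred; ｛_｝; _≐_; _⊆_; _⊢_; ∅)

record SetFunctor : Set₁ where
  field
    F₀   : Set → Set
    F₁   : ∀ {X Y} → (X → Y) → F₀ X → F₀ Y
    F-id : ∀ {X} → F₁ (id {A = X}) ≗ id
    F-∘  : ∀ {X Y Z} (g : Y → Z) (f : X → Y) → F₁ (g ∘ f) ≗ F₁ g ∘ F₁ f

module _ (T : SetFunctor) where
  open SetFunctor T

  record Coalgebra : Set₁ where
    constructor _,_
    field
      Carrier   : Set
      structure : Carrier → F₀ Carrier

  open Coalgebra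

  record Morphism (C D : Coalgebra) : Set where
    field
      map      : Carrier C → Carrier D
      commutes : F₁ map ∘ structure C ≗ structure D ∘ map

  BehaviourallyEquivalent : (C D : Coalgebra) → Carrier C → Carrier D → Set₁
  BehaviourallyEquivalent C D x y =
    ∃ λ (E : Coalgebra) → ∃₂ λ (h : Morphism C E) (k : Morphism D E) →
      Morphism.map h x ≡ Morphism.map k y

  record PredicateLifting (n : ℕ) : Set₁ where
    field
      apply   : ∀ {X} → (Fin n → Pred X 0ℓ) → Pred (F₀ X) 0ℓ
      natural : ∀ {X Y} (f : X → Y) (A : Fin n → Pred Y 0ℓ) →
                apply (λ i → f ⊢ A i) ≐ F₁ f ⊢ apply A

  open PredicateLifting

  Monotone : ∀ {n} → PredicateLifting n → Set₁
  Monotone {n} l = ∀ {X} (A B : Fin n → Pred X 0ℓ) →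
    (∀ i → A i ⊆ B i) → apply l A ⊆ apply l B

  SingletonPreserving : ∀ {n} → PredicateLifting n → Set₁
  SingletonPreserving {n} l = ∀ {X} (xs : Fin n → X) →
    ∃! _≡_ (apply l (λ i → ｛ xs i ｝))

  StronglyExpressive : {I : Set} (ar : I → ℕ) →
    ((i : I) → PredicateLifting (ar i)) → Set₁
  StronglyExpressive {I} ar l = ∀ {X} (t : F₀ X) →
    ∃₂ λ (i : I) (xs : Fin (ar i) → X) →
      ｛ t ｝ ≐ apply (l i) (λ j → ｛ xs j ｝)

  record Modalities : Set₁ where
    field
      Modality            : Set
      arity               : Modality → ℕ
      lifting             : (L : Modality) → PredicateLifting (arity L)
      monotone            : ∀ L → Monotone (lifting L)
      singletonPreserving : ∀ L → SingletonPreserving (lifting L)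
      stronglyExpressive  : StronglyExpressive arity lifting

record IsGreatestFixpoint {X : Set} (F : Pred X 0ℓ → Pred X 0ℓ)
                          (A : Pred X 0ℓ) : Set₁ where
  field
    fixed    : A ≐ F A
    greatest : ∀ B → B ≐ F B → B ⊆ A

-- Excluded middle at level 1 makes the union of all postfixed points, a
-- priori a predicate valued in Set₁, a predicate valued in Set, so that
-- Pred X 0ℓ serves as the powerset of X.
module GreatestFixpoint (em : ExcludedMiddle (lsuc 0ℓ)) {X : Set} where

  gfp : (Pred X 0ℓ → Pred X 0ℓ) → Pred X 0ℓ
  gfp F x = True (em {P = ∃ λ (Y : Pred X 0ℓ) → Y ⊆ F Y × Y x})

  module _ {F : Pred X 0ℓ → Pred X 0ℓ} where

    gfp-coinduction : ∀ Y → Y ⊆ F Y → Y ⊆ gfp F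
    gfp-coinduction Y post y∈Y = fromWitness (Y , post , y∈Y)

    module _ (mono : ∀ A B → A ⊆ B → F A ⊆ F B) where

      gfp-postfixed : gfp F ⊆ F (gfp F)
      gfp-postfixed x∈gfp =
        let (Y , post , x∈Y) = toWitness x∈gfp
        in mono Y (gfp F) (gfp-coinduction Y post) (post x∈Y)

      gfp-isGreatestFixpoint : IsGreatestFixpoint F (gfp F)
      gfp-isGreatestFixpoint = record
        { fixed    = gfp-postfixed
                   , gfp-coinduction (F (gfp F)) (mono _ _ gfp-postfixed)
        ; greatest = λ B (post , _) → gfp-coinduction B post
        }

module Expressions (em : ExcludedMiddle (lsuc 0ℓ)) (V : Set)
                   {T : SetFunctor} (𝓛 : Modalities T) where

  open SetFunctor T
  open Modalities 𝓛
  open PredicateLifting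
  open GreatestFixpoint em

  em₀ : ExcludedMiddle 0ℓ
  em₀ {P} = map′ lower lift (em {P = Lift (lsuc 0ℓ) P})

  _≟_ : DecidableEquality V
  x ≟ y = em₀

  data Expr : Set where
    var : V → Expr
    ν   : V → Expr → Expr
    op  : (L : Modality) → Vec Expr (arity L) → Expr

  -- Scoped Γ φ: every free variable of φ is in Γ.
  data Scoped (Γ : List V) : Expr → Set where
    var : ∀ {z} → z ∈ Γ → Scoped Γ (var z)
    ν   : ∀ {z φ} → Scoped (z ∷ Γ) φ → Scoped Γ (ν z φ)
    op  : ∀ {L φs} → All (Scoped Γ) φs → Scoped Γ (op L φs)

  Closed : Expr → Set
  Closed = Scoped []

  -- In GuardedFrom Δ φ, the list Δ holds the variables of the enclosing ν's
  -- that no modality separates from φ.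
  data GuardedFrom (Δ : List V) : Expr → Set where
    var : ∀ {z} → z ∉ Δ → GuardedFrom Δ (var z)
    ν   : ∀ {z φ} → GuardedFrom (z ∷ Δ) φ → GuardedFrom Δ (ν z φ)
    op  : ∀ {L φs} → All (GuardedFrom []) φs → GuardedFrom Δ (op L φs)

  Guarded : Expr → Set
  Guarded = GuardedFrom []

  -- The fields closed and guarded are irrelevant, so that elements of E₀ are
  -- equal as soon as the underlying expressions are.
  record E₀ : Set where
    constructor mkE₀
    field
      expr     : Expr
      .closed  : Closed expr
      .guarded : Guarded expr

  open E₀ public

  infix 7 _[_↦_]
  _[_↦_] : {A : Set₁} → (V → A) → V → A → (V → A)
  (κ [ z ↦ a ]) y with y ≟ z
  ... | yes _ = a
  ... | no  _ = κ y

  module Semantics (C : Coalgebra T) where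
    open Coalgebra C renaming (Carrier to X; structure to ξ)

    mutual
      ⟦_⟧[_] : Expr → (V → Pred X 0ℓ) → Pred X 0ℓ
      ⟦ var z ⟧[ κ ]   = κ z
      ⟦ ν z φ ⟧[ κ ]   = gfp (λ Y → ⟦ φ ⟧[ κ [ z ↦ Y ] ])
      ⟦ op L φs ⟧[ κ ] = ξ ⊢ apply (lifting L) (⟦ φs ⟧*[ κ ])

      ⟦_⟧*[_] : ∀ {n} → Vec Expr n → (V → Pred X 0ℓ) → Fin n → Pred X 0ℓ
      ⟦ φ ∷ φs ⟧*[ κ ] zero    = ⟦ φ ⟧[ κ ]
      ⟦ φ ∷ φs ⟧*[ κ ] (suc i) = ⟦ φs ⟧*[ κ ] i

    ↦-mono : ∀ {κ κ′ : V → Pred X 0ℓ} {x} (Y Y′ : Pred X 0ℓ) → Y ⊆ Y′ →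
             ∀ z → (z ≢ x → κ z ⊆ κ′ z) →
             (κ [ x ↦ Y ]) z ⊆ (κ′ [ x ↦ Y′ ]) z
    ↦-mono {x = x} Y Y′ Y⊆Y′ z κ⊆κ′ with z ≟ x
    ... | yes _  = Y⊆Y′
    ... | no z≢x = κ⊆κ′ z≢x

    gfp-mono : ∀ {F G : Pred X 0ℓ → Pred X 0ℓ} → (∀ Y → F Y ⊆ G Y) →
               gfp F ⊆ gfp G
    gfp-mono F⊆G x∈ =
      let (Y , post , x∈Y) = toWitness x∈
      in gfp-coinduction Y (λ y∈Y → F⊆G Y (post y∈Y)) x∈Y

    mutual
      ⟦⟧-mono : ∀ φ {κ κ′} → (∀ z → κ z ⊆ κ′ z) → ⟦ φ ⟧[ κ ] ⊆ ⟦ φ ⟧[ κ′ ]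
      ⟦⟧-mono (var z)   κ⊆κ′ = κ⊆κ′ z
      ⟦⟧-mono (ν z φ)   κ⊆κ′ = gfp-mono λ Y → ⟦⟧-mono φ λ y →
        ↦-mono Y Y id y (λ _ → κ⊆κ′ y)
      ⟦⟧-mono (op L φs) κ⊆κ′ = monotone L _ _ (⟦⟧*-mono φs κ⊆κ′)

      ⟦⟧*-mono : ∀ {n} (φs : Vec Expr n) {κ κ′} → (∀ z → κ z ⊆ κ′ z) →
                 ∀ i → ⟦ φs ⟧*[ κ ] i ⊆ ⟦ φs ⟧*[ κ′ ] i
      ⟦⟧*-mono (φ ∷ φs) κ⊆κ′ zero    = ⟦⟧-mono φ κ⊆κ′
      ⟦⟧*-mono (φ ∷ φs) κ⊆κ′ (suc i) = ⟦⟧*-mono φs κ⊆κ′ i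

    ⟦ν⟧-isGreatestFixpoint : ∀ z φ κ →
      IsGreatestFixpoint (λ Y → ⟦ φ ⟧[ κ [ z ↦ Y ] ]) ⟦ ν z φ ⟧[ κ ]
    ⟦ν⟧-isGreatestFixpoint z φ κ = gfp-isGreatestFixpoint λ A B A⊆B →
      ⟦⟧-mono φ λ y → ↦-mono A B A⊆B y (λ _ → id)

    mutual
      ⟦⟧-scoped : ∀ {Γ φ κ κ′} → Scoped Γ φ → (∀ {z} → z ∈ Γ → κ z ⊆ κ′ z) →
                  ⟦ φ ⟧[ κ ] ⊆ ⟦ φ ⟧[ κ′ ]
      ⟦⟧-scoped (var z∈Γ)     κ⊆κ′ = κ⊆κ′ z∈Γ
      ⟦⟧-scoped (ν s)         κ⊆κ′ = gfp-mono λ Y → ⟦⟧-scoped s λ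
        { {y} (here y≡z)  → ↦-mono Y Y id y (λ y≢z → ⊥-elim (y≢z y≡z))
        ; {y} (there y∈Γ) → ↦-mono Y Y id y (λ _ → κ⊆κ′ y∈Γ)
        }
      ⟦⟧-scoped (op {L} ss) κ⊆κ′ = monotone L _ _ (⟦⟧*-scoped ss κ⊆κ′)

      ⟦⟧*-scoped : ∀ {Γ n κ κ′} {φs : Vec Expr n} → All (Scoped Γ) φs →
                   (∀ {z} → z ∈ Γ → κ z ⊆ κ′ z) →
                   ∀ i → ⟦ φs ⟧*[ κ ] i ⊆ ⟦ φs ⟧*[ κ′ ] i
      ⟦⟧*-scoped (s ∷ ss) κ⊆κ′ zero    = ⟦⟧-scoped s κ⊆κ′
      ⟦⟧*-scoped (s ∷ ss) κ⊆κ′ (suc i) = ⟦⟧*-scoped ss κ⊆κ′ i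

    -- The valuation is immaterial by ⟦⟧-closed.
    ⟦_⟧ : E₀ → Pred X 0ℓ
    ⟦ φ ⟧ = ⟦ expr φ ⟧[ (λ _ → ∅) ]

    ⟦⟧-closed : ∀ φ κ → ⟦ φ ⟧ ≐ ⟦ expr φ ⟧[ κ ]
    ⟦⟧-closed (mkE₀ φ c _) κ = ⟦⟧-scoped c′ (λ ()) , ⟦⟧-scoped c′ (λ ())
      where
      c′ : Closed φ
      c′ = recompute em₀ c

  -- Only closed expressions ψ are substituted, so no capture can occur.
  mutual
    _[_/_] : Expr → Expr → V → Expr
    var z [ ψ / x ] with z ≟ x
    ... | yes _ = ψ
    ... | no  _ = var z
    ν z φ [ ψ / x ] with z ≟ x
    ... | yes _ = ν z φ
    ... | no  _ = ν z (φ [ ψ / x ])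
    op L φs [ ψ / x ] = op L (φs [ ψ / x ]*)

    _[_/_]* : ∀ {n} → Vec Expr n → Expr → V → Vec Expr n
    [] [ ψ / x ]*       = []
    (φ ∷ φs) [ ψ / x ]* = φ [ ψ / x ] ∷ φs [ ψ / x ]*

  mutual
    scoped-weaken : ∀ {Γ Γ′ φ} → (∀ {z} → z ∈ Γ → z ∈ Γ′) →
                    Scoped Γ φ → Scoped Γ′ φ
    scoped-weaken Γ⊆Γ′ (var z∈Γ) = var (Γ⊆Γ′ z∈Γ)
    scoped-weaken Γ⊆Γ′ (ν s)     = ν (scoped-weaken (λ
      { (here eq)  → here eq
      ; (there z∈) → there (Γ⊆Γ′ z∈)
      }) s)
    scoped-weaken Γ⊆Γ′ (op ss)   = op (scoped-weaken* Γ⊆Γ′ ss)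

    scoped-weaken* : ∀ {Γ Γ′ n} {φs : Vec Expr n} →
                     (∀ {z} → z ∈ Γ → z ∈ Γ′) →
                     All (Scoped Γ) φs → All (Scoped Γ′) φs
    scoped-weaken* Γ⊆Γ′ []       = []
    scoped-weaken* Γ⊆Γ′ (s ∷ ss) = scoped-weaken Γ⊆Γ′ s ∷ scoped-weaken* Γ⊆Γ′ ss

  mutual
    scoped-subst : ∀ {Γ Γ′ x φ ψ} → Closed ψ →
                   (∀ {z} → z ∈ Γ → z ≢ x → z ∈ Γ′) →
                   Scoped Γ φ → Scoped Γ′ (φ [ ψ / x ])
    scoped-subst {x = x} cψ Γ-x⊆Γ′ (var {z} z∈Γ) with z ≟ x
    ... | yes _  = scoped-weaken (λ ()) cψ
    ... | no z≢x = var (Γ-x⊆Γ′ z∈Γ z≢x)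
    scoped-subst {x = x} cψ Γ-x⊆Γ′ (ν {z} s) with z ≟ x
    ... | yes z≡x = ν (scoped-weaken-shadowed z≡x Γ-x⊆Γ′ s)
      where
      scoped-weaken-shadowed : ∀ {Γ Γ′ x z φ} → z ≡ x →
        (∀ {y} → y ∈ Γ → y ≢ x → y ∈ Γ′) →
        Scoped (z ∷ Γ) φ → Scoped (z ∷ Γ′) φ
      scoped-weaken-shadowed {z = z} refl sub = scoped-weaken λ
        { (here eq)      → here eq
        ; {y} (there y∈) → case-≟ y y∈
        }
        where
        case-≟ : ∀ y → _ → y ∈ (z ∷ _)
        case-≟ y y∈ with y ≟ z
        ... | yes y≡z = here y≡z
        ... | no y≢z  = there (sub y∈ y≢z)
    ... | no _ = ν (scoped-subst cψ (λ
      { (here eq)  _   → here eq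
      ; (there y∈) y≢x → there (Γ-x⊆Γ′ y∈ y≢x)
      }) s)
    scoped-subst cψ Γ-x⊆Γ′ (op ss) = op (scoped-subst* cψ Γ-x⊆Γ′ ss)

    scoped-subst* : ∀ {Γ Γ′ x n ψ} {φs : Vec Expr n} → Closed ψ →
                    (∀ {z} → z ∈ Γ → z ≢ x → z ∈ Γ′) →
                    All (Scoped Γ) φs → All (Scoped Γ′) (φs [ ψ / x ]*)
    scoped-subst* cψ sub []       = []
    scoped-subst* cψ sub (s ∷ ss) =
      scoped-subst cψ sub s ∷ scoped-subst* cψ sub ss

  guarded-weaken : ∀ {Γ Δ Δ′ φ} → (∀ {z} → z ∈ Γ → z ∈ Δ′ → z ∈ Δ) →
                   Scoped Γ φ → GuardedFrom Δ φ → GuardedFrom Δ′ φ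
  guarded-weaken sub (var z∈Γ) (var z∉Δ) = var (λ z∈Δ′ → z∉Δ (sub z∈Γ z∈Δ′))
  guarded-weaken sub (ν s)     (ν g)     = ν (guarded-weaken (λ
    { _          (here eq)   → here eq
    ; (here eq)  (there _)   → here eq
    ; (there z∈) (there z∈′) → there (sub z∈ z∈′)
    }) s g)
  guarded-weaken sub (op _)    (op gs)   = op gs

  mutual
    guarded-subst : ∀ {Δ x φ ψ} → Closed ψ → Guarded ψ →
                    GuardedFrom Δ φ → GuardedFrom Δ (φ [ ψ / x ])
    guarded-subst {x = x} cψ gψ (var {z} z∉Δ) with z ≟ x
    ... | yes _ = guarded-weaken (λ ()) cψ gψ
    ... | no  _ = var z∉Δ
    guarded-subst {x = x} cψ gψ (ν {z} g) with z ≟ x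
    ... | yes _ = ν g
    ... | no  _ = ν (guarded-subst cψ gψ g)
    guarded-subst cψ gψ (op gs) = op (guarded-subst* cψ gψ gs)

    guarded-subst* : ∀ {Δ x n ψ} {φs : Vec Expr n} → Closed ψ → Guarded ψ →
                     All (GuardedFrom Δ) φs → All (GuardedFrom Δ) (φs [ ψ / x ]*)
    guarded-subst* cψ gψ []       = []
    guarded-subst* cψ gψ (g ∷ gs) =
      guarded-subst cψ gψ g ∷ guarded-subst* cψ gψ gs

  guarded-unbind : ∀ {Δ Δ′ φ} → (∀ {z} → z ∈ Δ′ → z ∈ Δ) →
                   GuardedFrom Δ φ → GuardedFrom Δ′ φ
  guarded-unbind sub (var z∉Δ) = var (z∉Δ ∘ sub)
  guarded-unbind sub (ν g)     = ν (guarded-unbind (λ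
    { (here eq)  → here eq
    ; (there z∈) → there (sub z∈)
    }) g)
  guarded-unbind sub (op gs)   = op gs

  unguardedνs : Expr → ℕ
  unguardedνs (var _)  = 0
  unguardedνs (ν _ φ)  = suc (unguardedνs φ)
  unguardedνs (op _ _) = 0

  unguardedνs-subst : ∀ {Δ x φ ψ} → x ∈ Δ → GuardedFrom Δ φ →
                      unguardedνs (φ [ ψ / x ]) ≡ unguardedνs φ
  unguardedνs-subst {x = x} x∈Δ (var {z} z∉Δ) with z ≟ x
  ... | yes z≡x = ⊥-elim (z∉Δ (subst (_∈ _) (sym z≡x) x∈Δ))
  ... | no  _   = refl
  unguardedνs-subst {x = x} x∈Δ (ν {z} g) with z ≟ x
  ... | yes _ = refl
  ... | no  _ = cong suc (unguardedνs-subst (there x∈Δ) g)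
  unguardedνs-subst x∈Δ (op _) = refl

  Closed-body : ∀ {x φ} → Closed (ν x φ) → Scoped (x ∷ []) φ
  Closed-body (ν s) = s

  Guarded-body : ∀ {x φ} → Guarded (ν x φ) → GuardedFrom (x ∷ []) φ
  Guarded-body (ν g) = g

  Closed-unfold : ∀ {x φ} → Closed (ν x φ) → Closed (φ [ ν x φ / x ])
  Closed-unfold c =
    scoped-subst c (λ { (here eq) z≢x → ⊥-elim (z≢x eq) }) (Closed-body c)

  Guarded-unfold : ∀ {x φ} → Closed (ν x φ) → Guarded (ν x φ) →
                   Guarded (φ [ ν x φ / x ])
  Guarded-unfold c g =
    guarded-subst c g (guarded-unbind (λ ()) (Guarded-body g))

  unfold : ∀ x φ → .(Closed (ν x φ)) → .(Guarded (ν x φ)) → E₀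
  unfold x φ c g =
    mkE₀ (φ [ ν x φ / x ]) (Closed-unfold c) (Guarded-unfold c g)

  Closed-arguments : ∀ {L φs} → Closed (op L φs) → All Closed φs
  Closed-arguments (op cs) = cs

  Guarded-arguments : ∀ {L φs} → Guarded (op L φs) → All Guarded φs
  Guarded-arguments (op gs) = gs

  ¬Closed-var : ∀ {z} → Closed (var z) → ⊥
  ¬Closed-var (var ())

  arguments : ∀ L φs → .(Closed (op L φs)) → .(Guarded (op L φs)) →
              Fin (arity L) → E₀
  arguments L φs c g i = mkE₀ (lookup φs i)
    (lookup⁺ (Closed-arguments c) i) (lookup⁺ (Guarded-arguments g) i)

  ε-rec : ∀ n φ → .(Closed φ) → .(Guarded φ) → .(unguardedνs φ ≡ n) → F₀ E₀
  ε-rec n       (var z)   c g p = ⊥-elim-irr (¬Closed-var c)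
  ε-rec n       (op L φs) c g p =
    proj₁ (singletonPreserving L (arguments L φs c g))
  ε-rec zero    (ν x φ)   c g ()
  ε-rec (suc n) (ν x φ)   c g p =
    ε-rec n (φ [ ν x φ / x ]) (Closed-unfold c) (Guarded-unfold c g)
      (trans (unguardedνs-subst (here refl) (Guarded-body g)) (ℕ.suc-injective p))

  ε : E₀ → F₀ E₀
  ε (mkE₀ φ c g) = ε-rec (unguardedνs φ) φ c g refl

  ε-op : ∀ L φs .(c : Closed (op L φs)) .(g : Guarded (op L φs)) →
         ｛ ε (mkE₀ (op L φs) c g) ｝ ≐
           apply (lifting L) (λ i → ｛ arguments L φs c g i ｝)
  ε-op L φs c g = (λ { refl → proj₁ (proj₂ s) }) , proj₂ (proj₂ s)
    where
    s : ∃! _≡_ (apply (lifting L) (λ i → ｛ arguments L φs c g i ｝))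
    s = singletonPreserving L (arguments L φs c g)

  ε-ν : ∀ x φ .(c : Closed (ν x φ)) .(g : Guarded (ν x φ)) →
        ε (mkE₀ (ν x φ) c g) ≡ ε (unfold x φ c g)
  ε-ν x φ c g = fuel (unguardedνs φ) _ φ′ _ _ _
    (sym (recompute (_ ℕ.≟ _)
      (unguardedνs-subst {ψ = ν x φ} (here refl) (Guarded-body g))))
    where
    φ′ = expr (unfold x φ c g)
    fuel : ∀ m n ψ .(c : Closed ψ) .(g : Guarded ψ) .(p : unguardedνs ψ ≡ m) →
           (eq : m ≡ n) →
           ε-rec m ψ c g p ≡ ε-rec n ψ c g (trans p eq)
    fuel m .m ψ c g p refl = refl

  E₀-coalgebra : Coalgebra T
  E₀-coalgebra = E₀ , ε

{-# OPTIONS --safe #-}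

-- Call x and φ related when x ∈ ⟦ φ ⟧.  Unfolding the unguarded fixpoints of φ
-- gives a modality L and expressions φᵢ such that ξ x lies in
-- L(⟦ φ₁ ⟧, …, ⟦ φₙ ⟧) and ε φ in L({ φ₁ }, …, { φₙ }).  Any map r on X ⊎ E₀
-- that identifies related states therefore sends both to the unique element of
-- L({ r φ₁ }, …, { r φₙ }), so the coalgebra structure descends to the quotient
-- by the equivalence generated by the relation, and related states are
-- behaviourally equivalent.  Conversely, morphisms preserve and reflect the
-- semantics, so it is enough that φ ∈ ⟦ φ ⟧ in E₀; this follows by coinduction,
-- evaluating each ν-bound variable to the set of states with the same
-- ε-value as the expression that replaces it on unfolding.
module Submission where

open import Axiom.ExcludedMiddle using (ExcludedMiddle)
open import Axiom.Extensionality.Propositional using (Extensionality)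
open import Data.Bool using (Bool; T)
open import Data.Empty using (⊥; ⊥-elim; ⊥-elim-irr)
open import Data.Fin using (Fin; zero; suc)
open import Data.List.Membership.Propositional using (_∉_)
open import Data.List.Relation.Unary.Any using (here; there)
open import Data.Maybe using (Maybe; just; nothing; maybe)
open import Data.Nat using (ℕ; zero; suc)
import Data.Nat.Properties as ℕ
open import Data.Product using (∃; ∃₂; _×_; _,_; proj₁; proj₂)
open import Data.Sum using (_⊎_; inj₁; inj₂)
open import Data.Vec using (Vec; []; _∷_; lookup)
open import Data.Vec.Relation.Unary.All using (All; []; _∷_)
open import Function using (_∘_; id)
open import Function.Bundles using (_⇔_; mk⇔)
open import Level using (0ℓ) renaming (suc to lsuc)
open import Relation.Binary.Construct.Closure.Equivalence as Eq using (EqClosure)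
open import Relation.Binary.Construct.Closure.ReflexiveTransitive using (ε)
open import Relation.Binary.PropositionalEquality
open import Relation.Nullary using (yes; no)
open import Relation.Nullary.Decidable
  using (⌊_⌋; toWitness; fromWitness; recompute; isYes≗does; does-⇔)
open import Relation.Unary using (Pred; _∈_; _⊆_; _⊢_; ｛_｝; ∅)
open import Defs

-- Canonical representatives for a generated equivalence relation.

module _ (em : ExcludedMiddle 0ℓ) (ext : Extensionality 0ℓ 0ℓ)
         {A : Set} (R : A → A → Set) where

  private
    _~_ : A → A → Set
    _~_ = EqClosure R

    -- Classes take values in `Bool` so that equivalent elements have equal classes by `ext`; with
    -- values in `Set` they would be merely logically equivalent.
    class : A → A → Bool
    class a b = ⌊ em {P = a ~ b} ⌋

    class-cong : ∀ {a b} → a ~ b → class a ≡ class b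
    class-cong {a} {b} a~b = ext λ c →
      trans (isYes≗does (em {P = a ~ c}))
        (trans (does-⇔ (mk⇔ (Eq.transitive R (Eq.symmetric R a~b)) (Eq.transitive R a~b)) em em)
          (sym (isYes≗does (em {P = b ~ c}))))

    member : (p : A → Bool) → .(∃ λ a → T (p a)) → ∃ λ a → T (p a)
    member p = recompute em

    class-member : ∀ a → ∃ λ b → T (class a b)
    class-member a = member (class a) (a , fromWitness ε)

    member-cong : ∀ {p q} → p ≡ q → .(i : ∃ λ a → T (p a)) .(j : ∃ λ a → T (q a)) →
                  proj₁ (member p i) ≡ proj₁ (member q j)
    member-cong refl _ _ = refl

  -- The representative is a function of the equivalence class alone, since
  -- recompute ignores the proof of inhabitedness.
  representative : A → A
  representative a = proj₁ (class-member a)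

  representative-~ : ∀ a → EqClosure R a (representative a)
  representative-~ a = toWitness (proj₂ (class-member a))

  representative-cong : ∀ {a b} → EqClosure R a b →
                        representative a ≡ representative b
  representative-cong a~b = member-cong (class-cong a~b) _ _

module _ (em : ExcludedMiddle (lsuc 0ℓ)) (ext : Extensionality 0ℓ 0ℓ)
         (V : Set) {T : SetFunctor} (𝓛 : Modalities T) where

  open SetFunctor T
  open Modalities 𝓛
  open PredicateLifting
  open Expressions em V 𝓛 renaming (ε to δ)
  open GreatestFixpoint em
  open Semantics

  -- Kept general in `P` to serve plain inclusion as well as both comparisons along a morphism.
  ↦-lift : ∀ {A B : Set₁} {κ : V → A} {κ′ : V → B} {ℓ} (P : A → B → Set ℓ) {z a b} →
           P a b → (∀ y → y ≢ z → P (κ y) (κ′ y)) →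
           ∀ y → P ((κ [ z ↦ a ]) y) ((κ′ [ z ↦ b ]) y)
  ↦-lift P {z} pab pκ y with y ≟ z
  ... | yes _  = pab
  ... | no y≢z = pκ y y≢z

  -- Invariance of the semantics under coalgebra morphisms.

  module _ {C D : Coalgebra T} (h : Morphism T C D) where
    open Coalgebra C renaming (Carrier to X; structure to ξ)
    open Coalgebra D renaming (Carrier to Y; structure to ζ)
    open Morphism h

    mutual
      -- At a fixpoint, the direct image of a postfixed point is again postfixed; at a modality,
      -- naturality of the lifting meets the morphism square.
      ⟦⟧-preserved : ∀ φ {κ κ′} → (∀ z → κ z ⊆ map ⊢ κ′ z) →
                     ⟦_⟧[_] C φ κ ⊆ map ⊢ ⟦_⟧[_] D φ κ′
      ⟦⟧-preserved (var z) κ⊆κ′ = κ⊆κ′ z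
      ⟦⟧-preserved (ν z φ) κ⊆κ′ x∈ =
        let (A , post , x∈A) = toWitness x∈
            image = λ y → ∃ λ x → x ∈ A × map x ≡ y
        in gfp-coinduction image
             (λ { (x , x∈A , refl) → ⟦⟧-preserved φ
               (↦-lift (λ P Q → P ⊆ map ⊢ Q) (λ a∈A → _ , a∈A , refl) λ y _ → κ⊆κ′ y)
               (post x∈A) })
             (_ , x∈A , refl)
      ⟦⟧-preserved (op L φs) {κ} {κ′} κ⊆κ′ {x} x∈ =
        subst (apply (lifting L) (⟦_⟧*[_] D φs κ′)) (commutes x)
          (proj₁ (natural (lifting L) map _)
            (monotone L _ _ (⟦⟧*-preserved φs κ⊆κ′) x∈))

      ⟦⟧*-preserved : ∀ {n} (φs : Vec Expr n) {κ κ′} → (∀ z → κ z ⊆ map ⊢ κ′ z) →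
                      ∀ i → ⟦_⟧*[_] C φs κ i ⊆ map ⊢ ⟦_⟧*[_] D φs κ′ i
      ⟦⟧*-preserved (φ ∷ φs) κ⊆κ′ zero    = ⟦⟧-preserved φ κ⊆κ′
      ⟦⟧*-preserved (φ ∷ φs) κ⊆κ′ (suc i) = ⟦⟧*-preserved φs κ⊆κ′ i

    mutual
      -- Dual to preservation, with preimages of postfixed points in place of images.
      ⟦⟧-reflected : ∀ φ {κ κ′} → (∀ z → map ⊢ κ′ z ⊆ κ z) →
                     map ⊢ ⟦_⟧[_] D φ κ′ ⊆ ⟦_⟧[_] C φ κ
      ⟦⟧-reflected (var z) κ′⊆κ = κ′⊆κ z
      ⟦⟧-reflected (ν z φ) κ′⊆κ x∈ =
        let (B , post , hx∈B) = toWitness x∈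
        in gfp-coinduction (map ⊢ B)
             (λ hx∈B → ⟦⟧-reflected φ
               (↦-lift (λ P Q → map ⊢ Q ⊆ P) id λ y _ → κ′⊆κ y) (post hx∈B))
             hx∈B
      ⟦⟧-reflected (op L φs) {κ} {κ′} κ′⊆κ {x} x∈ =
        monotone L _ _ (⟦⟧*-reflected φs κ′⊆κ)
          (proj₂ (natural (lifting L) map _)
            (subst (apply (lifting L) (⟦_⟧*[_] D φs κ′)) (sym (commutes x)) x∈))

      ⟦⟧*-reflected : ∀ {n} (φs : Vec Expr n) {κ κ′} → (∀ z → map ⊢ κ′ z ⊆ κ z) →
                      ∀ i → map ⊢ ⟦_⟧*[_] D φs κ′ i ⊆ ⟦_⟧*[_] C φs κ i
      ⟦⟧*-reflected (φ ∷ φs) κ′⊆κ zero    = ⟦⟧-reflected φ κ′⊆κ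
      ⟦⟧*-reflected (φ ∷ φs) κ′⊆κ (suc i) = ⟦⟧*-reflected φs κ′⊆κ i

  -- Substitution, unfolding and the quotient coalgebra.

  module _ (C : Coalgebra T) where
    open Coalgebra C renaming (Carrier to X; structure to ξ)

    mutual
      -- Since `χ` is closed, its semantics does not change when binders of `φ` update the
      -- valuation.
      ⟦⟧-subst : ∀ φ (χ : E₀) {z κ κ′} → κ z ⊆ ⟦_⟧ C χ → (∀ y → y ≢ z → κ y ⊆ κ′ y) →
                 ⟦_⟧[_] C φ κ ⊆ ⟦_⟧[_] C (φ [ expr χ / z ]) κ′
      ⟦⟧-subst (var y) χ {z} κz⊆ κ⊆κ′ with y ≟ z
      ... | yes refl = proj₁ (⟦⟧-closed C χ _) ∘ κz⊆
      ... | no y≢z   = κ⊆κ′ y y≢z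
      ⟦⟧-subst (ν y φ) χ {z} κz⊆ κ⊆κ′ with y ≟ z
      -- The inner binder shadows `z`, so the substitution stops and the valuations matter only away
      -- from `z`.
      ... | yes refl = gfp-mono C λ Y → ⟦⟧-mono C φ
        (↦-lift (λ P Q → P ⊆ Q) id κ⊆κ′)
      ... | no y≢z   = gfp-mono C λ Y → ⟦⟧-subst φ χ (λ {x} → at-z Y {x})
        λ w w≢z → ↦-mono C Y Y id w λ _ → κ⊆κ′ w w≢z
        where
        at-z : ∀ Y → (_ [ y ↦ Y ]) z ⊆ ⟦_⟧ C χ
        at-z Y with z ≟ y
        ... | yes refl = ⊥-elim (y≢z refl)
        ... | no _     = κz⊆
      ⟦⟧-subst (op L φs) χ κz⊆ κ⊆κ′ = monotone L _ _ (⟦⟧*-subst φs χ κz⊆ κ⊆κ′)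

      ⟦⟧*-subst : ∀ {n} (φs : Vec Expr n) (χ : E₀) {z κ κ′} →
                  κ z ⊆ ⟦_⟧ C χ → (∀ y → y ≢ z → κ y ⊆ κ′ y) →
                  ∀ i → ⟦_⟧*[_] C φs κ i ⊆ ⟦_⟧*[_] C (φs [ expr χ / z ]*) κ′ i
      ⟦⟧*-subst (φ ∷ φs) χ κz⊆ κ⊆κ′ zero    = ⟦⟧-subst φ χ κz⊆ κ⊆κ′
      ⟦⟧*-subst (φ ∷ φs) χ κz⊆ κ⊆κ′ (suc i) = ⟦⟧*-subst φs χ κz⊆ κ⊆κ′ i

    ⟦⟧*-lookup : ∀ {n} (φs : Vec Expr n) {κ} i →
                 ⟦_⟧*[_] C φs κ i ⊆ ⟦_⟧[_] C (lookup φs i) κ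
    ⟦⟧*-lookup (φ ∷ φs) zero    = id
    ⟦⟧*-lookup (φ ∷ φs) (suc i) = ⟦⟧*-lookup φs i

    ⟦ν⟧-unfold : ∀ z φ .(c : Closed (ν z φ)) .(g : Guarded (ν z φ)) →
                 ⟦_⟧ C (mkE₀ (ν z φ) c g) ⊆ ⟦_⟧ C (unfold z φ c g)
    ⟦ν⟧-unfold z φ c g = ⟦⟧-subst φ χ (λ {x} → at-z {x}) off-z
        ∘ proj₁ (IsGreatestFixpoint.fixed (⟦ν⟧-isGreatestFixpoint C z φ _))
      where
      χ = mkE₀ (ν z φ) c g
      κ : V → Pred X 0ℓ
      κ _ = ∅
      at-z : (κ [ z ↦ ⟦_⟧ C χ ]) z ⊆ ⟦_⟧ C χ
      at-z with z ≟ z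
      ... | yes _  = id
      ... | no z≢z = ⊥-elim (z≢z refl)
      off-z : ∀ y → y ≢ z → (κ [ z ↦ ⟦_⟧ C χ ]) y ⊆ κ y
      off-z y y≢z with y ≟ z
      ... | yes y≡z = ⊥-elim (y≢z y≡z)
      ... | no _    = id

    CommonStep : X → E₀ → Set
    CommonStep x φ = ∃₂ λ (L : Modality) (φs : Fin (arity L) → E₀) →
      ξ x ∈ apply (lifting L) (λ i → ⟦_⟧ C (φs i)) ×
      δ φ ∈ apply (lifting L) (λ i → ｛ φs i ｝)

    -- An unfolding is not structurally smaller, so the recursion is on the number `n` of unguarded
    -- fixpoints: guardedness puts the substituted copies below modalities, and each unfolding
    -- lowers the count by one.
    commonStep : ∀ n φ .(c : Closed φ) .(g : Guarded φ) → .(unguardedνs φ ≡ n) →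
                 ∀ {x} → x ∈ ⟦_⟧ C (mkE₀ φ c g) → CommonStep x (mkE₀ φ c g)
    commonStep n (var z) c g p = ⊥-elim-irr (¬Closed-var c)
    commonStep n (op L φs) c g p x∈ =
      L , arguments L φs c g , monotone L _ _ (⟦⟧*-lookup φs) x∈ , proj₁ (ε-op L φs c g) refl
    commonStep zero (ν z φ) c g ()
    commonStep (suc n) (ν z φ) c g p x∈
      with commonStep n (φ [ ν z φ / z ]) (Closed-unfold c) (Guarded-unfold c g)
             (trans (unguardedνs-subst (here refl) (Guarded-body g)) (ℕ.suc-injective p))
             (⟦ν⟧-unfold z φ c g x∈)
    ... | L , φs , ξx∈ , δ∈ =
      L , φs , ξx∈ , subst (apply (lifting L) _) (sym (ε-ν z φ c g)) δ∈

    private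
      -- The quotient is realised on X ⊎ E₀ itself, by normalising successors
      -- to representatives.
      R : X ⊎ E₀ → X ⊎ E₀ → Set
      R (inj₁ x) (inj₂ φ) = x ∈ ⟦_⟧ C φ
      R _        _        = ⊥

      r : X ⊎ E₀ → X ⊎ E₀
      r = representative em₀ ext R

      step : X ⊎ E₀ → F₀ (X ⊎ E₀)
      step (inj₁ x) = F₁ (r ∘ inj₁) (ξ x)
      step (inj₂ φ) = F₁ (r ∘ inj₂) (δ φ)

      step-R : ∀ s t → R s t → step s ≡ step t
      step-R (inj₁ x) (inj₂ (mkE₀ φ c g)) x∈ with commonStep _ φ c g refl x∈
      ... | L , φs , ξx∈ , δφ∈ = trans (sym (unique s∈)) (unique t∈)
        where
        unique = proj₂ (proj₂ (singletonPreserving L (r ∘ inj₂ ∘ φs)))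
        -- States satisfying `φs i` share its representative, so the semantics of `φs i` lies in the
        -- preimage of a singleton.
        s∈ = proj₁ (natural (lifting L) (r ∘ inj₁) _) (monotone L _ _
          (λ i y∈ → sym (representative-cong em₀ ext R (Eq.return y∈))) ξx∈)
        t∈ = proj₁ (natural (lifting L) (r ∘ inj₂) _) (monotone L _ _
          (λ i eq → cong (r ∘ inj₂) eq) δφ∈)

      -- On each summand this is the morphism square for `r ∘ inj₁` or `r ∘ inj₂`, by the definition
      -- of `step`.
      step-r : ∀ s → step s ≡ step (r s)
      step-r s = Eq.gfold isEquivalence step (λ {s} {t} → step-R s t)
        (representative-~ em₀ ext R s)

    ⟦⟧⇒behaviourallyEquivalent : ∀ {x} φ → x ∈ ⟦_⟧ C φ →
      BehaviourallyEquivalent T C E₀-coalgebra x φ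
    ⟦⟧⇒behaviourallyEquivalent φ x∈ = ((X ⊎ E₀) , step)
      , record { map = r ∘ inj₁ ; commutes = step-r ∘ inj₁ }
      , record { map = r ∘ inj₂ ; commutes = step-r ∘ inj₂ }
      , representative-cong em₀ ext R (Eq.return x∈)

  -- Simultaneous instantiation of variables by closed expressions.

  Instantiation : Set
  Instantiation = V → Maybe E₀

  infix 7 _⟨_≔_⟩
  _⟨_≔_⟩ : Instantiation → V → Maybe E₀ → Instantiation
  (σ ⟨ z ≔ a ⟩) y with y ≟ z
  ... | yes _ = a
  ... | no  _ = σ y

  ≔-overwrite : ∀ σ z a b → σ ⟨ z ≔ a ⟩ ⟨ z ≔ b ⟩ ≡ σ ⟨ z ≔ b ⟩
  ≔-overwrite σ z a b = ext pointwise
    where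
    pointwise : ∀ y → (σ ⟨ z ≔ a ⟩ ⟨ z ≔ b ⟩) y ≡ (σ ⟨ z ≔ b ⟩) y
    pointwise y with y ≟ z in eq
    ... | yes _ = refl
    ... | no  _ rewrite eq = refl

  ≔-comm : ∀ σ {w z} a b → w ≢ z → σ ⟨ z ≔ a ⟩ ⟨ w ≔ b ⟩ ≡ σ ⟨ w ≔ b ⟩ ⟨ z ≔ a ⟩
  ≔-comm σ {w} {z} a b w≢z = ext pointwise
    where
    pointwise : ∀ y → (σ ⟨ z ≔ a ⟩ ⟨ w ≔ b ⟩) y ≡ (σ ⟨ w ≔ b ⟩ ⟨ z ≔ a ⟩) y
    pointwise y with y ≟ w in eqw | y ≟ z in eqz
    ... | yes refl | yes refl = ⊥-elim (w≢z refl)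
    ... | yes _    | no _ rewrite eqw = refl
    ... | no _     | yes _ rewrite eqz = refl
    ... | no _     | no _ rewrite eqw | eqz = refl

  mutual
    instantiate : Instantiation → Expr → Expr
    instantiate σ (var z)   = maybe expr (var z) (σ z)
    instantiate σ (ν z φ)   = ν z (instantiate (σ ⟨ z ≔ nothing ⟩) φ)
    instantiate σ (op L φs) = op L (instantiate* σ φs)

    instantiate* : ∀ {n} → Instantiation → Vec Expr n → Vec Expr n
    instantiate* σ []       = []
    instantiate* σ (φ ∷ φs) = instantiate σ φ ∷ instantiate* σ φs

  mutual
    instantiate-nothing : ∀ φ → instantiate (λ _ → nothing) φ ≡ φ
    instantiate-nothing (var z)   = refl
    instantiate-nothing (ν z φ)   = cong (ν z)
      (trans (cong (λ σ → instantiate σ φ) (ext pointwise)) (instantiate-nothing φ))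
      where
      pointwise : ∀ y → ((λ _ → nothing) ⟨ z ≔ nothing ⟩) y ≡ nothing
      pointwise y with y ≟ z
      ... | yes _ = refl
      ... | no  _ = refl
    instantiate-nothing (op L φs) = cong (op L) (instantiate*-nothing φs)

    instantiate*-nothing : ∀ {n} (φs : Vec Expr n) → instantiate* (λ _ → nothing) φs ≡ φs
    instantiate*-nothing []       = refl
    instantiate*-nothing (φ ∷ φs) =
      cong₂ _∷_ (instantiate-nothing φ) (instantiate*-nothing φs)

  mutual
    subst-fresh : ∀ {Γ φ ψ x} → x ∉ Γ → Scoped Γ φ → φ [ ψ / x ] ≡ φ
    subst-fresh {x = x} x∉Γ (var {z} z∈Γ) with z ≟ x
    ... | yes refl = ⊥-elim (x∉Γ z∈Γ)
    ... | no _     = refl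
    subst-fresh {x = x} x∉Γ (ν {z} s) with z ≟ x
    ... | yes _  = refl
    ... | no z≢x = cong (ν z) (subst-fresh
      (λ { (here x≡z) → z≢x (sym x≡z) ; (there x∈Γ) → x∉Γ x∈Γ }) s)
    subst-fresh x∉Γ (op ss) = cong (op _) (subst-fresh* x∉Γ ss)

    subst-fresh* : ∀ {Γ n ψ x} {φs : Vec Expr n} → x ∉ Γ → All (Scoped Γ) φs →
                   φs [ ψ / x ]* ≡ φs
    subst-fresh* x∉Γ []       = refl
    subst-fresh* x∉Γ (s ∷ ss) = cong₂ _∷_ (subst-fresh x∉Γ s) (subst-fresh* x∉Γ ss)

  subst-E₀ : ∀ (χ : E₀) {ψ x} → expr χ [ ψ / x ] ≡ expr χ
  subst-E₀ (mkE₀ φ c _) = subst-fresh (λ ()) (recompute em₀ c)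

  var-subst-≡ : ∀ z {ψ} → var z [ ψ / z ] ≡ ψ
  var-subst-≡ z with z ≟ z
  ... | yes _  = refl
  ... | no z≢z = ⊥-elim (z≢z refl)

  var-subst-≢ : ∀ {y z ψ} → y ≢ z → var y [ ψ / z ] ≡ var y
  var-subst-≢ {y} {z} y≢z with y ≟ z
  ... | yes y≡z = ⊥-elim (y≢z y≡z)
  ... | no _    = refl

  mutual
    -- Identifies the unfolding of an instantiated fixpoint with an instance of its body.
    -- Expressions supplied by `σ` are closed, so the later substitution leaves them alone.
    instantiate-subst : ∀ σ φ z (χ : E₀) →
      instantiate (σ ⟨ z ≔ nothing ⟩) φ [ expr χ / z ] ≡ instantiate (σ ⟨ z ≔ just χ ⟩) φ
    instantiate-subst σ (var y) z χ with y ≟ z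
    ... | yes refl = var-subst-≡ z
    ... | no y≢z with σ y
    ...   | just χ′ = subst-E₀ χ′
    ...   | nothing = var-subst-≢ y≢z
    instantiate-subst σ (ν w φ) z χ with w ≟ z
    ... | yes refl = cong (λ σ → ν z (instantiate σ φ))
      (trans (≔-overwrite σ z _ _) (sym (≔-overwrite σ z _ _)))
    -- Commuting the updates makes the one at `z` outermost, as the induction hypothesis requires.
    ... | no w≢z
      rewrite ≔-comm σ nothing nothing w≢z | ≔-comm σ (just χ) nothing w≢z =
      cong (ν w) (instantiate-subst (σ ⟨ w ≔ nothing ⟩) φ z χ)
    instantiate-subst σ (op L φs) z χ = cong (op L) (instantiate*-subst σ φs z χ)

    instantiate*-subst : ∀ {n} σ (φs : Vec Expr n) z (χ : E₀) →
      instantiate* (σ ⟨ z ≔ nothing ⟩) φs [ expr χ / z ]* ≡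
      instantiate* (σ ⟨ z ≔ just χ ⟩) φs
    instantiate*-subst σ []       z χ = refl
    instantiate*-subst σ (φ ∷ φs) z χ =
      cong₂ _∷_ (instantiate-subst σ φ z χ) (instantiate*-subst σ φs z χ)

  -- Every expression satisfies itself.

  -- States with the same δ-value are identified because a fixpoint and its
  -- unfolding are distinct states of E₀ that δ does not separate.
  Instance : Instantiation → Expr → Pred E₀ 0ℓ
  Instance σ φ ψ = ∃ λ χ → expr χ ≡ instantiate σ φ × δ χ ≡ δ ψ

  Instance-≔ : ∀ σ z χ y →
    Instance (σ ⟨ z ≔ just χ ⟩) (var y) ⊆
    ((λ w → Instance σ (var w)) [ z ↦ (λ ψ → δ χ ≡ δ ψ) ]) y
  Instance-≔ σ z χ y with y ≟ z
  -- Proof fields of `E₀` are irrelevant, so equality of expressions already forces the instance to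
  -- be `χ`.
  ... | yes _ = λ { (mkE₀ _ _ _ , refl , eq) → eq }
  ... | no  _ = id

  mutual
    Instance⊆⟦⟧ : ∀ φ σ →
      Instance σ φ ⊆ ⟦_⟧[_] E₀-coalgebra φ (λ z → Instance σ (var z))
    Instance⊆⟦⟧ (var z) σ = id
    Instance⊆⟦⟧ (ν z φ) σ (χ@(mkE₀ _ c g) , refl , eq) =
      -- This set is postfixed: by `ε-ν`, a state with the value of `χ` also has the value of its
      -- unfolding, which is an instance of the body with `χ` for `z`.
      gfp-coinduction (λ ψ → δ χ ≡ δ ψ)
        (λ {ψ} eq → ⟦⟧-mono E₀-coalgebra φ (Instance-≔ σ z χ)
          (Instance⊆⟦⟧ φ (σ ⟨ z ≔ just χ ⟩)
            (unfold z _ c g , instantiate-subst σ φ z χ , trans (sym (ε-ν z _ c g)) eq)))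
        eq
    Instance⊆⟦⟧ (op L φs) σ (mkE₀ _ c g , refl , eq) =
      -- Below a modality the successors are the instantiated arguments themselves, so both
      -- equations hold by `refl`.
      monotone L _ _ (λ { i refl → Instance⊆⟦⟧* φs σ i (_ , refl , refl) })
        (proj₁ (ε-op L _ c g) eq)

    -- Here `lookup` comes after `instantiate*`, which is how `arguments` presents the successors.
    Instance⊆⟦⟧* : ∀ {n} (φs : Vec Expr n) σ i →
      (λ ψ → ∃ λ χ → expr χ ≡ lookup (instantiate* σ φs) i × δ χ ≡ δ ψ) ⊆
      ⟦_⟧*[_] E₀-coalgebra φs (λ z → Instance σ (var z)) i
    Instance⊆⟦⟧* (φ ∷ φs) σ zero    = Instance⊆⟦⟧ φ σ
    Instance⊆⟦⟧* (φ ∷ φs) σ (suc i) = Instance⊆⟦⟧* φs σ i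

  E₀-satisfies-itself : ∀ φ → φ ∈ ⟦_⟧ E₀-coalgebra φ
  E₀-satisfies-itself φ = proj₂ (⟦⟧-closed E₀-coalgebra φ _)
    (Instance⊆⟦⟧ (expr φ) (λ _ → nothing)
      (φ , sym (instantiate-nothing (expr φ)) , refl))

  behaviourallyEquivalent⇒⟦⟧ : ∀ {C x} φ →
    BehaviourallyEquivalent T C E₀-coalgebra x φ → x ∈ ⟦_⟧ C φ
  behaviourallyEquivalent⇒⟦⟧ φ (E , h , k , hx≡kφ) =
    ⟦⟧-reflected h (expr φ) (λ _ ())
      (subst (⟦_⟧ E φ) (sym hx≡kφ)
        (⟦⟧-preserved k (expr φ) (λ _ ()) (E₀-satisfies-itself φ)))

mainTheorem16 :
    (em : ExcludedMiddle (lsuc 0ℓ)) → Extensionality 0ℓ 0ℓ →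
    (V : Set) {T : SetFunctor} (𝓛 : Modalities T) →
    let open Expressions em V 𝓛
        open Semantics using (⟦_⟧)
    in
    ((φ : E₀) (C : Coalgebra T) (x : Coalgebra.Carrier C) →
       x ∈ ⟦_⟧ C φ ⇔ BehaviourallyEquivalent T C E₀-coalgebra x φ)
    × ((φ : E₀) → φ ∈ ⟦_⟧ E₀-coalgebra φ)
mainTheorem16 em ext V 𝓛 =
    (λ φ C x → mk⇔ (⟦⟧⇒behaviourallyEquivalent em ext V 𝓛 C φ)
                   (behaviourallyEquivalent⇒⟦⟧ em ext V 𝓛 φ))
  , E₀-satisfies-itself em ext V 𝓛
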